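{- Let $G$ be a graph on at least two vertices and let $\overline{G}$ be its complement. Then $|\gamma^{DLD}(G)-\gamma^{DLD}(\overline{G})|\le 1$, and $\gamma^{DLD}(G)\ne\gamma^{DLD}(\overline{G})$ if and only if $G$ is a complete graph or an edgeless graph.
   Context: All graphs are finite, simple and undirected (not necessarily connected). For $u\in V$, $N(u)$ is the set of neighbours of $u$ and $N[u]=N(u)\cup\{u\}$. A code is a non-empty subset $C\subseteq V$; $I(C;u)=N[u]\cap C$ (computed in the relevant graph). A code $C$ is solid-locating-dominating if $I(C;u)\ne\emptyset$ for every $u\in V\setminus C$ and $I(C;u)\not\subseteq I(C;v)$ for all distinct $u,v\in V\setminus C$; $\gamma^{DLD}(G)$ is the minimum size of such a code in $G$. -}

module Defs where

open import Data.Fin using (Fin; zero)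
open import Data.Fin.Properties using (all?; _≟_)
open import Data.Fin.Subset
  using (Subset; _∉_; _⊈_; _∩_; _∪_; ⁅_⁆; ⊤; ∣_∣; Nonempty)
open import Data.Fin.Subset.Properties
  using (_∈?_; _⊆?_; nonempty?; anySubset?; ∈⊤)
open import Data.Nat using (ℕ; zero; suc; _≤_; z≤n; s≤s; NonZero)
import Data.Nat.Properties as ℕ
open import Data.Product using (Σ; ∃; _×_; _,_; proj₁)
open import Data.Vec using (tabulate)
open import Relation.Binary.Core using (Rel)
open import Relation.Binary.Definitions using (Symmetric; Irreflexive; Decidable)
open import Relation.Binary.PropositionalEquality using (_≡_; _≢_; refl; sym)
open import Relation.Nullary using (Dec; yes; no; does; ¬_; ¬?; contradiction; _×-dec_; _→-dec_)
import Relation.Unary as U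
open import Level using (0ℓ)

-- Finite simple graphs with vertex set Fin n.  Decidability of adjacency is
-- automatic classically; here it makes neighbourhoods finite subsets.
record Graph (n : ℕ) : Set₁ where
  field
    Adj    : Rel (Fin n) 0ℓ
    adj?   : Decidable Adj
    symm   : Symmetric Adj
    irrefl : Irreflexive _≡_ Adj

open Graph public

private
  variable
    n : ℕ

complement : Graph n → Graph n
complement G = record
  { Adj    = λ u v → u ≢ v × ¬ Adj G u v
  ; adj?   = λ u v → ¬? (u ≟ v) ×-dec ¬? (adj? G u v)
  ; symm   = λ (u≢v , ¬uv) → (λ v≡u → u≢v (sym v≡u)) , λ vu → ¬uv (symm G vu)
  ; irrefl = λ u≡v (u≢v , _) → u≢v u≡v
  }

IsComplete : Graph n → Set
IsComplete G = ∀ u v → u ≢ v → Adj G u v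

IsEdgeless : Graph n → Set
IsEdgeless G = ∀ u v → ¬ Adj G u v

N : Graph n → Fin n → Subset n
N G u = tabulate λ v → does (adj? G u v)

N[_] : Graph n → Fin n → Subset n
N[ G ] u = N G u ∪ ⁅ u ⁆

I : Graph n → Subset n → Fin n → Subset n
I G C u = N[ G ] u ∩ C

record IsSolidLD (G : Graph n) (C : Subset n) : Set where
  constructor solidLD
  field
    nonempty   : Nonempty C
    dominating : ∀ u → u ∉ C → Nonempty (I G C u)
    solid      : ∀ u v → u ∉ C → v ∉ C → u ≢ v → I G C u ⊈ I G C v

isSolidLD? : (G : Graph n) → U.Decidable (IsSolidLD G)
isSolidLD? G C
  with nonempty? C
     | all? (λ u → ¬? (u ∈? C) →-dec nonempty? (I G C u))
     | all? (λ u → all? λ v →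
         ¬? (u ∈? C) →-dec (¬? (v ∈? C) →-dec
           (¬? (u ≟ v) →-dec ¬? (I G C u ⊆? I G C v))))
... | yes p | yes q | yes r = yes (solidLD p q r)
... | no ¬p | _     | _     = no λ c → ¬p (IsSolidLD.nonempty c)
... | yes _ | no ¬q | _     = no λ c → ¬q (IsSolidLD.dominating c)
... | yes _ | yes _ | no ¬r = no λ c → ¬r (IsSolidLD.solid c)

⊤-isSolidLD : .{{_ : NonZero n}} (G : Graph n) → IsSolidLD G ⊤
⊤-isSolidLD {suc n} G = solidLD (zero , ∈⊤)
  (λ u u∉⊤ → contradiction ∈⊤ u∉⊤)
  (λ u v u∉⊤ → contradiction ∈⊤ u∉⊤)

HasCodeOfSize : Graph n → ℕ → Set
HasCodeOfSize {n} G k = Σ (Subset n) λ C → IsSolidLD G C × ∣ C ∣ ≡ k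

hasCodeOfSize? : (G : Graph n) → U.Decidable (HasCodeOfSize G)
hasCodeOfSize? G k = anySubset? λ C → isSolidLD? G C ×-dec (∣ C ∣ ℕ.≟ k)

IsLeast : (ℕ → Set) → ℕ → Set
IsLeast P m = P m × (∀ j → P j → m ≤ j)

least : {P : ℕ → Set} → U.Decidable P → ∀ k → P k → ∃ (IsLeast P)
least P? k pk with P? 0
... | yes p0 = 0 , p0 , λ _ _ → z≤n
least P? zero    pk | no ¬p0 = contradiction pk ¬p0
least P? (suc k) pk | no ¬p0 with least (λ j → P? (suc j)) k pk
... | m , pm , m≤ = suc m , pm , λ where
  zero    p0 → contradiction p0 ¬p0
  (suc j) pj → s≤s (m≤ j pj)

-- On a non-empty vertex set the whole vertex set is a code, so the minimum exists.
minimumCodeSize : .{{_ : NonZero n}} (G : Graph n) → ∃ (IsLeast (HasCodeOfSize G))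
minimumCodeSize {n} G =
  least (hasCodeOfSize? G) ∣ ⊤ {n} ∣ (⊤ , ⊤-isSolidLD G , refl)

γᴰᴸᴰ : .{{_ : NonZero n}} → Graph n → ℕ
γᴰᴸᴰ G = proj₁ (minimumCodeSize G)

{-# OPTIONS --safe #-}
-- For u ∉ C, I(C;u) taken in the complement is C ∖ I(C;u), so complementation
-- preserves the antichain condition.  With two non-codewords the antichain condition
-- also gives I(C;u) ≠ C, that is, domination in the complement.  A code with at
-- most one non-codeword has size at least n − 1, and a graph with an edge uv
-- always has the code V ∖ {u}.
module Submission where

open import Defs
open import Data.Bool using (true)
open import Data.Empty using (⊥-elim)
open import Data.Fin using (Fin; zero; suc)
open import Data.Fin.Properties using (any?; _≟_)
open import Data.Fin.Subset using (Subset; _∈_; _∉_; _⊆_; ⁅_⁆; ∁; ⊤; ∣_∣; Nonempty)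
open import Data.Fin.Subset.Properties
open import Data.Nat using (ℕ; zero; suc; pred; _≤_; _∸_; s≤s; z≤n; ∣_-_∣; NonZero)
open import Data.Nat.Properties using (≤-refl; ≤-trans; ≤-reflexive; ≤-antisym; ∣n-n∣≡0; ∣-∣-comm; 1+n≢n)
open import Data.Product using (∃; ∃₂; _×_; _,_; proj₁; proj₂)
open import Data.Sum using (_⊎_; inj₁; inj₂)
open import Data.Vec.Properties using ([]=⇒lookup; lookup⇒[]=; lookup∘tabulate)
open import Function.Bundles using (_⇔_; mk⇔)
open import Relation.Binary.PropositionalEquality using (_≡_; _≢_; refl; sym; trans; cong; subst; ≢-sym)
open import Relation.Nullary using (¬_; ¬?; yes; no; does; contradiction; _×-dec_)
open import Relation.Nullary.Decidable using (Dec; dec-true; decidable-stable)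

private
  variable
    n : ℕ

does⇒ : {A : Set} (a? : Dec A) → does a? ≡ true → A
does⇒ (yes a) _ = a

∈N⁺ : (G : Graph n) {u x : Fin n} → Adj G u x → x ∈ N G u
∈N⁺ G {u} {x} ux = lookup⇒[]= x (N G u)
  (trans (lookup∘tabulate _ x) (dec-true (adj? G u x) ux))

∈N⁻ : (G : Graph n) {u x : Fin n} → x ∈ N G u → Adj G u x
∈N⁻ G {u} {x} x∈ = does⇒ (adj? G u x)
  (trans (sym (lookup∘tabulate _ x)) ([]=⇒lookup x∈))

∈I⁺ : (G : Graph n) {C : Subset n} {u x : Fin n} → x ∈ C → Adj G u x → x ∈ I G C u
∈I⁺ G x∈C ux = x∈p∩q⁺ (x∈p∪q⁺ (inj₁ (∈N⁺ G ux)) , x∈C)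

-- For a non-codeword, closed and open neighbourhoods meet `C` in the same set, since the extra
-- vertex `u` lies outside `C`.
∈I⁻ : (G : Graph n) {C : Subset n} {u x : Fin n} → u ∉ C → x ∈ I G C u → x ∈ C × Adj G u x
∈I⁻ G {C} {u} u∉C x∈I with x∈p∩q⁻ (N[ G ] u) C x∈I
... | x∈N[u] , x∈C with x∈p∪q⁻ (N G u) ⁅ u ⁆ x∈N[u]
...   | inj₁ x∈N = x∈C , ∈N⁻ G x∈N
...   | inj₂ x∈⁅u⁆ = contradiction (subst (_∈ C) (x∈⁅y⁆⇒x≡y u x∈⁅u⁆) x∈C) u∉C

∈∧∉⇒≢ : {C : Subset n} {x y : Fin n} → x ∈ C → y ∉ C → y ≢ x
∈∧∉⇒≢ x∈C y∉C refl = y∉C x∈C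

-- Symmetric in G and H, unlike H ≡ complement G, which complementing twice
-- returns only up to equivalence of adjacency.
record Complementary (G H : Graph n) : Set where
  field
    exclusive : ∀ {u v} → Adj G u v → ¬ Adj H u v
    exhaustive : ∀ {u v} → u ≢ v → Adj G u v ⊎ Adj H u v

open Complementary

complementary-sym : {G H : Graph n} → Complementary G H → Complementary H G
complementary-sym GH .exclusive Huv Guv = exclusive GH Guv Huv
complementary-sym GH .exhaustive u≢v with exhaustive GH u≢v
... | inj₁ Guv = inj₂ Guv
... | inj₂ Huv = inj₁ Huv

complement-complementary : (G : Graph n) → Complementary G (complement G)
complement-complementary G .exclusive Guv (_ , ¬Guv) = ¬Guv Guv
complement-complementary G .exhaustive {u} {v} u≢v with adj? G u v
... | yes Guv = inj₁ Guv
... | no ¬Guv = inj₂ (u≢v , ¬Guv)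

edgeless⇒complementComplete : {G H : Graph n} → Complementary G H → IsEdgeless H → IsComplete G
edgeless⇒complementComplete GH H-edgeless u v u≢v with exhaustive GH u≢v
... | inj₁ Guv = Guv
... | inj₂ Huv = contradiction Huv (H-edgeless u v)

HasEdge : Graph n → Set
HasEdge G = ∃₂ λ u v → Adj G u v

hasEdge⊎edgeless : (G : Graph n) → HasEdge G ⊎ IsEdgeless G
hasEdge⊎edgeless G with any? (λ u → any? λ v → adj? G u v)
... | yes e = inj₁ e
... | no ¬e = inj₂ λ u v uv → ¬e (u , v , uv)

complete⇒complementEdgeless : {G H : Graph n} → Complementary G H → IsComplete G → IsEdgeless H
complete⇒complementEdgeless {H = H} GH G-complete u v Huv =
  exclusive GH (G-complete u v λ u≡v → irrefl H u≡v Huv) Huv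

TwoNonCodewords : Subset n → Set
TwoNonCodewords C = ∃₂ λ u v → u ∉ C × v ∉ C × u ≢ v

∣∁⁅u⁆∣≡pred : (u : Fin n) → ∣ ∁ ⁅ u ⁆ ∣ ≡ pred n
∣∁⁅u⁆∣≡pred {suc n} u = trans (∣∁p∣≡n∸∣p∣ ⁅ u ⁆) (cong (suc n ∸_) (∣⁅x⁆∣≡1 u))

-- Without two distinct non-codewords, `C` contains every vertex except possibly one vertex `w`.
twoNonCodewords⊎large : (C : Subset (suc n)) → TwoNonCodewords C ⊎ n ≤ ∣ C ∣
twoNonCodewords⊎large {n} C
  with any? (λ u → any? λ v → ¬? (u ∈? C) ×-dec (¬? (v ∈? C) ×-dec ¬? (u ≟ v)))
... | yes two = inj₁ two
... | no ¬two = inj₂ (≤-trans (≤-reflexive (sym (∣∁⁅u⁆∣≡pred w))) (p⊆q⇒∣p∣≤∣q∣ ∁w⊆C))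
  where
  onlyNonCodeword : ∃ λ w → ∀ {x} → x ≢ w → x ∈ C
  onlyNonCodeword with any? (λ u → ¬? (u ∈? C))
  ... | yes (u , u∉C) = u , λ {x} x≢u → decidable-stable (x ∈? C)
          λ x∉C → ¬two (x , u , x∉C , u∉C , x≢u)
  -- Here `C` is the whole vertex set, so any vertex can serve as `w`.
  ... | no ¬u∉C = zero , λ {x} _ → decidable-stable (x ∈? C) λ x∉C → ¬u∉C (x , x∉C)

  w : Fin (suc n)
  w = proj₁ onlyNonCodeword

  ∁w⊆C : ∁ ⁅ w ⁆ ⊆ C
  ∁w⊆C x∈∁ = proj₂ onlyNonCodeword λ { refl → x∈∁p⇒x∉p x∈∁ (x∈⁅x⁆ w) }

solidLD-complementary : {G H : Graph n} {C : Subset n} → Complementary G H →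
  TwoNonCodewords C → IsSolidLD G C → IsSolidLD H C
solidLD-complementary {n} {G} {H} {C} GH (a , b , a∉C , b∉C , a≢b) (solidLD ne dom sol) =
  solidLD ne domᴴ solᴴ
  where
  other : ∀ u → ∃ λ v → v ∉ C × v ≢ u
  other u with a ≟ u
  ... | no a≢u = a , a∉C , a≢u
  ... | yes refl = b , b∉C , ≢-sym a≢b

  domᴴ : ∀ u → u ∉ C → Nonempty (I H C u)
  domᴴ u u∉C with nonempty? (I H C u) | other u
  ... | yes p | _ = p
  -- If `u` has no `H`-neighbour in `C`, all codewords are `G`-neighbours of `u`, so `I G C u` is
  -- all of `C` and contains `I G C v`.
  ... | no empty | v , v∉C , v≢u = ⊥-elim (sol v u v∉C u∉C v≢u Iv⊆Iu)
    where
    Iv⊆Iu : I G C v ⊆ I G C u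
    Iv⊆Iu x∈Iv with x∈C ← proj₁ (∈I⁻ G v∉C x∈Iv)
      with exhaustive GH (∈∧∉⇒≢ x∈C u∉C)
    ... | inj₁ Gux = ∈I⁺ G x∈C Gux
    ... | inj₂ Hux = contradiction (_ , ∈I⁺ H x∈C Hux) empty

  solᴴ : ∀ u v → u ∉ C → v ∉ C → u ≢ v → ¬ (I H C u ⊆ I H C v)
  -- Taking complements within `C` reverses inclusion, so `sol` is applied with `u` and `v`
  -- exchanged.
  solᴴ u v u∉C v∉C u≢v Iu⊆Iv = sol v u v∉C u∉C (≢-sym u≢v) Iv⊆Iu
    where
    Iv⊆Iu : I G C v ⊆ I G C u
    Iv⊆Iu x∈Iv with ∈I⁻ G v∉C x∈Iv
    ... | x∈C , Gvx with exhaustive GH (∈∧∉⇒≢ x∈C u∉C)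
    ...   | inj₁ Gux = ∈I⁺ G x∈C Gux
    ...   | inj₂ Hux = contradiction (proj₂ (∈I⁻ H v∉C (Iu⊆Iv (∈I⁺ H x∈C Hux)))) (exclusive GH Gvx)

-- The only non-codeword is `u`: its neighbour `v` dominates it, and there is no pair to separate.
∁⁅u⁆-solidLD : (G : Graph n) {u v : Fin n} → Adj G u v → IsSolidLD G (∁ ⁅ u ⁆)
∁⁅u⁆-solidLD G {u} {v} uv = solidLD (v , v∈∁) dom
  λ x y x∉∁ y∉∁ x≢y → contradiction (trans (nonCodeword x∉∁) (sym (nonCodeword y∉∁))) x≢y
  where
  v∈∁ : v ∈ ∁ ⁅ u ⁆
  v∈∁ = x∉p⇒x∈∁p λ v∈ → irrefl G (sym (x∈⁅y⁆⇒x≡y u v∈)) uv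

  nonCodeword : ∀ {x} → x ∉ ∁ ⁅ u ⁆ → x ≡ u
  nonCodeword x∉∁ = x∈⁅y⁆⇒x≡y u (x∉∁p⇒x∈p x∉∁)

  dom : ∀ x → x ∉ ∁ ⁅ u ⁆ → Nonempty (I G (∁ ⁅ u ⁆) x)
  dom x x∉∁ with refl ← nonCodeword x∉∁ = v , ∈I⁺ G v∈∁ uv

-- Every non-codeword is adjacent to all of `C`, so two of them would have the same `I`-set.
complete⇒¬twoNonCodewords : {G : Graph n} {C : Subset n} → IsComplete G →
  IsSolidLD G C → ¬ TwoNonCodewords C
complete⇒¬twoNonCodewords {G = G} G-complete c (u , v , u∉C , v∉C , u≢v) =
  IsSolidLD.solid c u v u∉C v∉C u≢v λ x∈Iu →
    let x∈C = proj₁ (∈I⁻ G u∉C x∈Iu)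
    in ∈I⁺ G x∈C (G-complete v _ (∈∧∉⇒≢ x∈C v∉C))

edgeless⇒⊤⊆code : {G : Graph n} {C : Subset n} → IsEdgeless G → IsSolidLD G C → ⊤ ⊆ C
edgeless⇒⊤⊆code {G = G} {C} G-edgeless c {u} _ = decidable-stable (u ∈? C) λ u∉C →
  let x , x∈I = IsSolidLD.dominating c u u∉C
  in G-edgeless u x (proj₂ (∈I⁻ G u∉C x∈I))

-- A code with two non-codewords serves `H` unchanged. Any other code has at least `n` elements,
-- which is the size of the code obtained by omitting one end of an edge of `H`.
transferCode : {G H : Graph (suc n)} {C : Subset (suc n)} → Complementary G H → HasEdge H →
  IsSolidLD G C → ∃ λ D → IsSolidLD H D × ∣ D ∣ ≤ ∣ C ∣
transferCode {H = H} {C} GH (u , v , uv) c with twoNonCodewords⊎large C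
... | inj₁ two = C , solidLD-complementary GH two c , ≤-refl
... | inj₂ n≤∣C∣ = ∁ ⁅ u ⁆ , ∁⁅u⁆-solidLD H uv , ≤-trans (≤-reflexive (∣∁⁅u⁆∣≡pred u)) n≤∣C∣

complete⇒n≤∣code∣ : {G : Graph (suc n)} {C : Subset (suc n)} → IsComplete G →
  IsSolidLD G C → n ≤ ∣ C ∣
complete⇒n≤∣code∣ {C = C} G-complete c with twoNonCodewords⊎large C
... | inj₁ two = contradiction two (complete⇒¬twoNonCodewords G-complete c)
... | inj₂ n≤∣C∣ = n≤∣C∣

edgeless⇒n≤∣code∣ : {G : Graph n} {C : Subset n} → IsEdgeless G → IsSolidLD G C → n ≤ ∣ C ∣
edgeless⇒n≤∣code∣ {n} G-edgeless c =
  ≤-trans (≤-reflexive (sym (∣⊤∣≡n n))) (p⊆q⇒∣p∣≤∣q∣ (edgeless⇒⊤⊆code G-edgeless c))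

-- The minimum is described by IsLeast, because comparing occurrences of γᴰᴸᴰ
-- makes the type checker unfold the exhaustive search.
IsMinCodeSize : Graph n → ℕ → Set
IsMinCodeSize G = IsLeast (HasCodeOfSize G)

private
  variable
    g h k : ℕ

minCodeSize≤ : {G : Graph n} {C : Subset n} → IsMinCodeSize G g → IsSolidLD G C → ∣ C ∣ ≤ k → g ≤ k
minCodeSize≤ {C = C} (_ , least) c = ≤-trans (least ∣ C ∣ (C , c , refl))

≤minCodeSize : {G : Graph n} → IsMinCodeSize G g → (∀ {C} → IsSolidLD G C → k ≤ ∣ C ∣) → k ≤ g
≤minCodeSize ((C , c , refl) , _) k≤ = k≤ c

minCodeSize-edgeless : .{{_ : NonZero n}} {G : Graph n} → IsMinCodeSize G g → IsEdgeless G → g ≡ n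
minCodeSize-edgeless {G = G} g-min G-edgeless = ≤-antisym
  (minCodeSize≤ g-min (⊤-isSolidLD G) (∣p∣≤n ⊤))
  (≤minCodeSize g-min (edgeless⇒n≤∣code∣ G-edgeless))

minCodeSize-complete : {G : Graph (suc (suc n))} → IsMinCodeSize G g → IsComplete G → g ≡ suc n
minCodeSize-complete {n} {G = G} g-min G-complete = ≤-antisym
  -- With at least two vertices, completeness makes `zero` and `suc zero` adjacent, which supplies
  -- the required edge.
  (minCodeSize≤ g-min (∁⁅u⁆-solidLD G (G-complete zero (suc zero) λ ()))
    (≤-reflexive (∣∁⁅u⁆∣≡pred {suc (suc n)} zero)))
  (≤minCodeSize g-min (complete⇒n≤∣code∣ G-complete))

minCodeSize-edgeless-complement : {G H : Graph (suc (suc n))} → Complementary G H →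
  IsMinCodeSize G g → IsMinCodeSize H h → IsEdgeless H → h ≡ suc g
minCodeSize-edgeless-complement GH g-min h-min H-edgeless =
  trans (minCodeSize-edgeless h-min H-edgeless)
    (cong suc (sym (minCodeSize-complete g-min (edgeless⇒complementComplete GH H-edgeless))))

-- Applied in both directions, this gives equal minima when both graphs have an edge.
hasEdge⇒minCodeSize≤ : {G H : Graph (suc n)} → Complementary G H →
  IsMinCodeSize G g → IsMinCodeSize H h → HasEdge H → h ≤ g
hasEdge⇒minCodeSize≤ GH g-min h-min e = ≤minCodeSize g-min λ c →
  let D , d , ∣D∣≤∣C∣ = transferCode GH e c in minCodeSize≤ h-min d ∣D∣≤∣C∣

∣1+n-n∣≤1 : ∀ n → ∣ suc n - n ∣ ≤ 1
∣1+n-n∣≤1 zero    = s≤s z≤n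
∣1+n-n∣≤1 (suc n) = ∣1+n-n∣≤1 n

minCodeSizes-complementary : {G H : Graph (suc (suc n))} → Complementary G H →
  IsMinCodeSize G g → IsMinCodeSize H h →
  (∣ g - h ∣ ≤ 1) × ((g ≢ h) ⇔ (IsComplete G ⊎ IsEdgeless G))
minCodeSizes-complementary {g = g} {h} {G} {H} GH g-min h-min
  with hasEdge⊎edgeless G | hasEdge⊎edgeless H
-- Here `H` is complete and `g` is `suc h`, so the minima differ by exactly one.
... | inj₂ G-edgeless | _
  with refl ← minCodeSize-edgeless-complement (complementary-sym GH) h-min g-min G-edgeless =
    ∣1+n-n∣≤1 h ,
    mk⇔ (λ _ → inj₂ G-edgeless) (λ _ → 1+n≢n)
... | inj₁ _ | inj₂ H-edgeless
  with refl ← minCodeSize-edgeless-complement GH g-min h-min H-edgeless =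
    subst (_≤ 1) (∣-∣-comm (suc g) g) (∣1+n-n∣≤1 g) ,
    mk⇔ (λ _ → inj₁ (edgeless⇒complementComplete GH H-edgeless)) (λ _ → ≢-sym 1+n≢n)
-- Transfer both ways makes the minima equal; the edge `xy` of `H` shows that `G` is not complete,
-- and `uv` that it is not edgeless.
... | inj₁ e@(u , v , uv) | inj₁ eᴴ@(x , y , xy)
  with refl ← ≤-antisym (hasEdge⇒minCodeSize≤ (complementary-sym GH) h-min g-min e)
                        (hasEdge⇒minCodeSize≤ GH g-min h-min eᴴ) =
    ≤-trans (≤-reflexive (∣n-n∣≡0 g)) z≤n ,
    mk⇔ (contradiction refl) λ where
      (inj₁ G-complete) → contradiction xy (complete⇒complementEdgeless GH G-complete x y)
      (inj₂ G-edgeless) → contradiction uv (G-edgeless u v)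

mainTheorem9 : ∀ (n : ℕ) .{{_ : NonZero n}} → 2 ≤ n → (G : Graph n) →
    (∣ γᴰᴸᴰ G - γᴰᴸᴰ (complement G) ∣ ≤ 1) ×
    ((γᴰᴸᴰ G ≢ γᴰᴸᴰ (complement G)) ⇔ (IsComplete G ⊎ IsEdgeless G))
mainTheorem9 (suc (suc n)) (s≤s (s≤s z≤n)) G =
  minCodeSizes-complementary {g = γᴰᴸᴰ G} {h = γᴰᴸᴰ (complement G)} (complement-complementary G)
    (proj₂ (minimumCodeSize G)) (proj₂ (minimumCodeSize (complement G)))
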